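{- Every $\mathcal{E}$-Luzin set is in $\mathcal{E}^*$.
   Context: $2^\omega$ is the Cantor space with coordinatewise addition modulo 2 and $\mathcal{E}$ is the $\sigma$-ideal on $2^\omega$ generated by closed Lebesgue measure zero sets. An uncountable set $X\subseteq 2^\omega$ is an $\mathcal{E}$-Luzin set if $X\cap F$ is countable for every $F\in\mathcal{E}$. $\mathcal{E}^*=\{X\subseteq 2^\omega:\forall E\in\mathcal{E}\ X+E\neq 2^\omega\}$, where $X+E=\{x+e:x\in X,e\in E\}$. -}

module Defs where

open import Algebra.Definitions.RawMonoid using (sum)
open import Data.Bool using (Bool; _xor_)
open import Data.Fin using (Fin; toℕ)
open import Data.List using (List; []; _∷_; length; lookup)
open import Data.Nat using (ℕ) renaming (_<_ to _<ℕ_)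
open import Data.Product using (_×_; ∃-syntax; Σ-syntax)
open import Data.Rational using (ℚ; 0ℚ; 1ℚ; ½; _*_; _<_; _≤_; +-0-rawMonoid)
open import Level using (0ℓ; suc)
open import Relation.Binary.PropositionalEquality using (_≡_; _≗_)
open import Relation.Nullary using (¬_)
open import Relation.Unary using (Pred; _∈_; _⊆_; _∩_; _≐_; ∁; ∅; U; ⋃)

-- 2^ω.  Function extensionality is not assumed: equality of points is
-- pointwise equality _≗_, and the notions below (countability, closedness,
-- nullity, sumsets) do not distinguish points related by _≗_.
Cantor : Set
Cantor = ℕ → Bool

-- Coordinatewise addition modulo 2.
infixl 6 _+₂_
_+₂_ : Cantor → Cantor → Cantor
(x +₂ y) i = x i xor y i

infixl 6 _⊕_
_⊕_ : Pred Cantor 0ℓ → Pred Cantor 0ℓ → Pred Cantor 0ℓ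
(X ⊕ E) z = ∃[ x ] ∃[ e ] (x ∈ X × e ∈ E × z ≗ x +₂ e)

-- At most countable; the enumeration may repeat and may leave A, so the
-- empty set and finite sets are included.
Countable : Pred Cantor 0ℓ → Set
Countable A = Σ[ f ∈ (ℕ → Cantor) ] (∀ x → x ∈ A → ∃[ n ] x ≗ f n)

-- The product topology, with the sets of sequences agreeing with x on the
-- first n coordinates as basic neighbourhoods of x.
Open : Pred Cantor 0ℓ → Set
Open V = ∀ x → x ∈ V → ∃[ n ] (∀ y → (∀ i → i <ℕ n → x i ≡ y i) → y ∈ V)

Closed : Pred Cantor 0ℓ → Set
Closed F = Open (∁ F)

-- The cylinder of all points extending the finite string s.
Cylinder : List Bool → Pred Cantor 0ℓ
Cylinder s x = (i : Fin (length s)) → x (toℕ i) ≡ lookup s i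

-- The measure 2^(-|s|) of the cylinder of s.
μ : List Bool → ℚ
μ []      = 1ℚ
μ (_ ∷ s) = ½ * μ s

-- Lebesgue outer measure zero: for every ε > 0 there is a countable cover by
-- cylinders of total measure at most ε.  The bound on the infinite sum of
-- nonnegative terms is expressed through its partial sums.
Null : Pred Cantor 0ℓ → Set
Null A = ∀ ε → 0ℚ < ε →
  Σ[ s ∈ (ℕ → List Bool) ]
         (A ⊆ ⋃ ℕ (λ k → Cylinder (s k))
          × (∀ n → sum +-0-rawMonoid {n} (λ i → μ (s (toℕ i))) ≤ ε))

-- The least family of subsets of 2^ω that contains 𝒢 and is closed under
-- subsets and countable unions.
data σ-Ideal (𝒢 : Pred (Pred Cantor 0ℓ) 0ℓ) : Pred (Pred Cantor 0ℓ) (suc 0ℓ) where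
  generator : ∀ {A} → A ∈ 𝒢 → A ∈ σ-Ideal 𝒢
  empty     : ∅ ∈ σ-Ideal 𝒢
  subset    : ∀ {A B} → A ⊆ B → B ∈ σ-Ideal 𝒢 → A ∈ σ-Ideal 𝒢
  union     : ∀ {A : ℕ → Pred Cantor 0ℓ} →
              (∀ n → A n ∈ σ-Ideal 𝒢) → ⋃ ℕ A ∈ σ-Ideal 𝒢

ℰ : Pred (Pred Cantor 0ℓ) (suc 0ℓ)
ℰ = σ-Ideal (λ F → Closed F × Null F)

ℰ-Luzin : Pred (Pred Cantor 0ℓ) (suc 0ℓ)
ℰ-Luzin X = ¬ Countable X × (∀ F → F ∈ ℰ → Countable (X ∩ F))

ℰ* : Pred (Pred Cantor 0ℓ) (suc 0ℓ)
ℰ* X = ∀ E → E ∈ ℰ → ¬ (X ⊕ E ≐ U)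

{-# OPTIONS --safe #-}

-- Write E ⊆ ⋃ Fₙ with Fₙ closed null and increasing.  By compactness ω splits
-- into consecutive blocks Iₙ such that Gₙ = {x : x agrees on Iₙ with a point
-- of Fₙ} has measure at most εₙ, where εₙ → 0.  If infinitely many blocks are
-- reserved, the set E' of all x that lie in Gₙ for all but finitely many
-- reserved n is in ℰ, so X ∩ E' has a countable enumeration f.  Let c vanish on
-- the reserved blocks and coincide on the others with wₙ + f k, where wₙ ∉ Gₙ
-- and every k is treated infinitely often.  If c = x + e with e ∈ E, then x
-- coincides with e on the reserved blocks, so x ∈ E' and x = f k for some k;
-- then e coincides with wₙ on some block with e ∈ Fₙ, contradicting wₙ ∉ Gₙ.
-- The points wₙ exist since 2^ω ∉ ℰ, as X is uncountable.
module Submission where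

open import Defs
open import Algebra.Definitions.RawMonoid using (sum)
open import Axiom.DoubleNegationElimination using (em⇒dne)
open import Axiom.ExcludedMiddle using (ExcludedMiddle)
open import Data.Bool using (Bool; true; false; _xor_; _≟_)
open import Data.Bool.Properties using (xor-assoc; xor-comm; xor-same; xor-identityʳ; ¬-not)
open import Data.Fin using (toℕ; zero; suc)
open import Data.Fin.Properties using (toℕ<n)
open import Data.Integer using (+_; +[1+_]; -[1+_]; +≤+; +<+)
open import Data.List using (List; []; _∷_; _∷ʳ_; length; replicate)
open import Data.Nat using (ℕ; zero; suc; _⊔_; z≤n; s≤s)
  renaming (_≤_ to _≤ℕ_; _<_ to _<ℕ_; _+_ to _+ℕ_; _*_ to _*ℕ_; _≤?_ to _≤ℕ?_; _≟_ to _≟ℕ_)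
import Data.Nat.Properties as ℕ
open import Data.Product using (_×_; _,_; proj₁; proj₂; ∃; ∃-syntax; Σ-syntax)
open import Data.Rational using (ℚ; mkℚ; 0ℚ; ½; _+_; _*_; _<_; _≤_; toℚᵘ; fromℚᵘ;
  +-0-rawMonoid; *<*)
import Data.Rational.Properties as ℚ
open import Data.Rational.Unnormalised using (mkℚᵘ; *≤*) renaming (_≤_ to _≤ᵘ_; _*_ to _*ᵘ_)
import Data.Rational.Unnormalised.Properties as ℚᵘ
open import Data.Sum using (inj₁; inj₂)
open import Function using (_∘_; const)
open import Level using (0ℓ)
open import Relation.Binary.PropositionalEquality
open import Relation.Nullary using (¬_; Dec; yes; no; does; contradiction)
open import Relation.Nullary.Decidable using (dec-true; dec-false)
open import Relation.Unary using (Pred; _∈_; _∉_; _⊆_; _∪_; _∩_; ∅; U; ⋃)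

total : (ℕ → List Bool) → ℕ → ℚ
total s n = sum +-0-rawMonoid {n} (λ i → μ (s (toℕ i)))

Cover : ℚ → Pred Cantor 0ℓ → Set
Cover ε A = Σ[ s ∈ (ℕ → List Bool) ] (A ⊆ ⋃ ℕ (λ k → Cylinder (s k)) × (∀ n → total s n ≤ ε))

ClosedNull : Pred Cantor 0ℓ → Set
ClosedNull A = Closed A × Null A

Agree : ℕ → Cantor → Cantor → Set
Agree n x y = ∀ i → i <ℕ n → x i ≡ y i

-- Rational arithmetic

½p+½p≡p : ∀ p → ½ * p + ½ * p ≡ p
½p+½p≡p p = trans (sym (ℚ.*-distribʳ-+ p ½ ½)) (ℚ.*-identityˡ p)

½-pos : ∀ {ε} → 0ℚ < ε → 0ℚ < ½ * ε
½-pos = ℚ.*-monoʳ-<-pos ½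

1/suc : ℕ → ℚ
1/suc n = fromℚᵘ (mkℚᵘ (+ 1) n)

1/suc-≤ : ∀ {n q} → mkℚᵘ (+ 1) n ≤ᵘ toℚᵘ q → 1/suc n ≤ q
1/suc-≤ {n} le = ℚ.toℚᵘ-cancel-≤
  (ℚᵘ.≤-trans (ℚᵘ.≤-reflexive (ℚ.toℚᵘ-fromℚᵘ (mkℚᵘ (+ 1) n))) le)

1/suc-antitone : ∀ m n → m ≤ℕ n → 1/suc n ≤ 1/suc m
1/suc-antitone m n m≤n = 1/suc-≤ (ℚᵘ.≤-trans
  (*≤* (+≤+ (ℕ.*-monoʳ-≤ 1 (s≤s m≤n))))
  (ℚᵘ.≤-reflexive (ℚᵘ.≃-sym (ℚ.toℚᵘ-fromℚᵘ (mkℚᵘ (+ 1) m)))))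

1/suc-pos : ∀ n → 0ℚ < 1/suc n
1/suc-pos n = ℚ.positive⁻¹ (1/suc n) {{ℚ.normalize-pos 1 (suc n)}}

archimedean : ∀ ε → 0ℚ < ε → ∃[ n ] 1/suc n ≤ ε
archimedean (mkℚ +[1+ p ] d _) _ =
  d , 1/suc-≤ (*≤* (+≤+ (ℕ.*-monoˡ-≤ (suc d) (s≤s {n = p} z≤n))))
archimedean (mkℚ (+ 0)    _ _) (*<* (+<+ ()))
archimedean (mkℚ -[1+ _ ] _ _) (*<* ())

-- Halving outpaces the harmonic decay because n + 2 ≤ 2(n + 1); with `archimedean` this gives
-- cylinders of arbitrarily small measure.
μ-replicate : ∀ n → μ (replicate n true) ≤ 1/suc n
μ-replicate zero    = ℚ.≤-refl
μ-replicate (suc n) = ℚ.≤-trans (ℚ.*-monoˡ-≤-nonNeg ½ (μ-replicate n)) (ℚ.toℚᵘ-cancel-≤ (begin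
    toℚᵘ (½ * 1/suc n)        ≃⟨ ℚ.toℚᵘ-homo-* ½ (1/suc n) ⟩
    toℚᵘ ½ *ᵘ toℚᵘ (1/suc n)  ≃⟨ ℚᵘ.*-congˡ {toℚᵘ ½} (ℚ.toℚᵘ-fromℚᵘ (mkℚᵘ (+ 1) n)) ⟩
    toℚᵘ ½ *ᵘ mkℚᵘ (+ 1) n    ≤⟨ *≤* (+≤+ (ℕ.*-monoʳ-≤ 1 bound)) ⟩
    mkℚᵘ (+ 1) (suc n)        ≃⟨ ℚᵘ.≃-sym (ℚ.toℚᵘ-fromℚᵘ (mkℚᵘ (+ 1) (suc n))) ⟩
    toℚᵘ (1/suc (suc n))      ∎))
  where
  open ℚᵘ.≤-Reasoning
  bound : suc (suc n) ≤ℕ 2 *ℕ suc n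
  bound = s≤s (ℕ.≤-trans (ℕ.≤-reflexive (ℕ.+-comm 1 n)) (ℕ.+-monoʳ-≤ n (s≤s z≤n)))

μ-nonNeg : ∀ s → 0ℚ ≤ μ s
μ-nonNeg []      = ℚ.<⇒≤ (ℚ.positive⁻¹ _)
μ-nonNeg (_ ∷ s) = ℚ.*-monoˡ-≤-nonNeg ½ (μ-nonNeg s)

-- Null sets

-- Every added bit halves the measure, so the measures form a geometric series.
pad : List Bool → ℕ → List Bool
pad s zero    = s
pad s (suc k) = pad (true ∷ s) k

total-pad : ∀ s n → total (pad s) n ≤ μ s + μ s
total-pad s zero    = ℚ.+-mono-≤ (μ-nonNeg s) (μ-nonNeg s)
total-pad s (suc n) = ℚ.+-monoʳ-≤ (μ s)
  (ℚ.≤-trans (total-pad (true ∷ s) n) (ℚ.≤-reflexive (½p+½p≡p (μ s))))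

-- A cover names a cylinder at every index, each of positive measure, so even here a convergent
-- series has to be supplied.
Null-∅ : Null ∅
Null-∅ ε ε>0 with n , le ← archimedean ε ε>0 =
  -- The extra `true` offsets the factor 2 in `total-pad`.
  pad (true ∷ replicate n true) , (λ ()) , λ k → ℚ.≤-trans (total-pad _ k)
    (ℚ.≤-trans (ℚ.≤-reflexive (½p+½p≡p (μ (replicate n true)))) (ℚ.≤-trans (μ-replicate n) le))

interleave : {A : Set} → (ℕ → A) → (ℕ → A) → ℕ → A
interleave s t zero    = s zero
interleave s t (suc k) = interleave t (s ∘ suc) k

interleaveˡ : {A : Set} (s t : ℕ → A) → ∀ k → ∃[ j ] interleave s t j ≡ s k
interleaveʳ : {A : Set} (s t : ℕ → A) → ∀ k → ∃[ j ] interleave s t j ≡ t k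
interleaveˡ s t zero    = 0 , refl
interleaveˡ s t (suc k) with j , eq ← interleaveʳ t (s ∘ suc) k = suc j , eq
interleaveʳ s t k with j , eq ← interleaveˡ t (s ∘ suc) k = suc j , eq

total-suc : ∀ s n → total s n ≤ total s (suc n)
total-suc s zero    = ℚ.+-mono-≤ (μ-nonNeg (s 0)) (ℚ.≤-refl {0ℚ})
total-suc s (suc n) = ℚ.+-monoʳ-≤ (μ (s 0)) (total-suc (s ∘ suc) n)

-- The first `n` interleaved terms occur among the first `n` terms of `s` and the first `n` terms of
-- `t`.
total-interleave : ∀ s t n → total (interleave s t) n ≤ total s n + total t n
total-interleave s t zero    = ℚ.≤-refl
total-interleave s t (suc n) = begin
  μ (s 0) + total (interleave t (s ∘ suc)) n  ≤⟨ ℚ.+-monoʳ-≤ (μ (s 0)) (total-interleave t (s ∘ suc) n) ⟩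
  μ (s 0) + (total t n + total (s ∘ suc) n)   ≡⟨ cong (_+_ (μ (s 0))) (ℚ.+-comm (total t n) _) ⟩
  μ (s 0) + (total (s ∘ suc) n + total t n)   ≡⟨ ℚ.+-assoc (μ (s 0)) _ _ ⟨
  total s (suc n) + total t n                 ≤⟨ ℚ.+-monoʳ-≤ (total s (suc n)) (total-suc t n) ⟩
  total s (suc n) + total t (suc n)           ∎
  where open ℚ.≤-Reasoning

Null-∪ : ∀ {A B} → Null A → Null B → Null (A ∪ B)
Null-∪ {A} {B} nA nB ε ε>0 with nA (½ * ε) (½-pos ε>0) | nB (½ * ε) (½-pos ε>0)
... | s , A⊆ , s≤ | t , B⊆ , t≤ = interleave s t , (λ {x} → A∪B⊆ {x}) , λ n → ℚ.≤-trans (total-interleave s t n)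
        (ℚ.≤-trans (ℚ.+-mono-≤ (s≤ n) (t≤ n)) (ℚ.≤-reflexive (½p+½p≡p ε)))
  where
  A∪B⊆ : A ∪ B ⊆ ⋃ ℕ (λ k → Cylinder (interleave s t k))
  A∪B⊆ {x} (inj₁ x∈A) with k , c ← A⊆ x∈A with j , eq ← interleaveˡ s t k =
    j , subst (λ u → Cylinder u x) (sym eq) c
  A∪B⊆ {x} (inj₂ x∈B) with k , c ← B⊆ x∈B with j , eq ← interleaveʳ s t k =
    j , subst (λ u → Cylinder u x) (sym eq) c

-- Translations

xor-cancel-same : ∀ a b → (a xor b) xor b ≡ a
xor-cancel-same a b = trans (xor-assoc a b b) (trans (cong (a xor_) (xor-same b)) (xor-identityʳ a))

xor-shift : ∀ a {b c} → a xor b ≡ c → a ≡ c xor b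
xor-shift a {b} refl = sym (xor-cancel-same a b)

xor-cancelʳ : ∀ {p q} r → p xor r ≡ q xor r → p ≡ q
xor-cancelʳ {p} {q} r eq = trans (xor-shift p eq) (xor-cancel-same q r)

translate : Cantor → List Bool → List Bool
translate t []      = []
translate t (b ∷ s) = (b xor t 0) ∷ translate (t ∘ suc) s

μ-translate : ∀ t s → μ (translate t s) ≡ μ s
μ-translate t []      = refl
μ-translate t (b ∷ s) = cong (½ *_) (μ-translate (t ∘ suc) s)

Cylinder-translate : ∀ t s {x} → Cylinder s (x +₂ t) → Cylinder (translate t s) x
Cylinder-translate t (b ∷ s) {x} p zero    = xor-shift (x 0) (p zero)
Cylinder-translate t (b ∷ s)     {x} p (suc i) = Cylinder-translate (t ∘ suc) s {x ∘ suc} (p ∘ suc) i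

total-cong : ∀ s t → (∀ k → μ (s k) ≡ μ (t k)) → ∀ n → total s n ≡ total t n
total-cong s t eq zero    = refl
total-cong s t eq (suc n) = cong₂ _+_ (eq 0) (total-cong (s ∘ suc) (t ∘ suc) (eq ∘ suc) n)

Null-translate : ∀ {A} t → Null A → Null (λ x → A (x +₂ t))
Null-translate t nA ε ε>0 with s , A⊆ , s≤ ← nA ε ε>0 =
  translate t ∘ s ,
  (λ {x} x∈ → proj₁ (A⊆ x∈) , Cylinder-translate t (s _) {x} (proj₂ (A⊆ x∈))) ,
  λ n → ℚ.≤-trans (ℚ.≤-reflexive (total-cong (translate t ∘ s) s (μ-translate t ∘ s) n)) (s≤ n)

-- Closed sets and compactness

Closed-∪ : ∀ {A B} → Closed A → Closed B → Closed (A ∪ B)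
Closed-∪ cA cB x x∉ with cA x (x∉ ∘ inj₁) | cB x (x∉ ∘ inj₂)
... | m , p | n , q = m ⊔ n , λ y agree → λ where
  (inj₁ y∈A) → p y (λ i i<m → agree i (ℕ.m<n⇒m<n⊔o n i<m)) y∈A
  (inj₂ y∈B) → q y (λ i i<n → agree i (ℕ.m<n⇒m<o⊔n m i<n)) y∈B

Closed-translate : ∀ {A} t → Closed A → Closed (λ x → A (x +₂ t))
Closed-translate t cA x x∉ with n , p ← cA (x +₂ t) x∉ =
  n , λ y agree → p (y +₂ t) (λ i i<n → cong (_xor t i) (agree i i<n))

ClosedNull-∅ : ClosedNull ∅
ClosedNull-∅ = (λ _ _ → 0 , λ _ _ ()) , Null-∅

ClosedNull-∪ : ∀ {A B} → ClosedNull A → ClosedNull B → ClosedNull (A ∪ B)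
ClosedNull-∪ (cA , nA) (cB , nB) = Closed-∪ cA cB , Null-∪ nA nB

Open-⋃-Cylinder : ∀ (s : ℕ → List Bool) → Open (⋃ ℕ (λ k → Cylinder (s k)))
Open-⋃-Cylinder s x (k , p) =
  length (s k) , λ y agree → k , λ i → trans (sym (agree (toℕ i) (toℕ<n i))) (p i)

restrict : Cantor → ℕ → List Bool
restrict z zero    = []
restrict z (suc n) = z 0 ∷ restrict (z ∘ suc) n

Cylinder-restrict⇒Agree : ∀ z n {x} → Cylinder (restrict z n) x → Agree n z x
Cylinder-restrict⇒Agree z (suc n) p zero    _         = sym (p zero)
Cylinder-restrict⇒Agree z (suc n) p (suc i) (s≤s i<n) =
  Cylinder-restrict⇒Agree (z ∘ suc) n (p ∘ suc) i i<n

Cylinder-∷ʳ : ∀ u {x} → Cylinder u x → Cylinder (u ∷ʳ x (length u)) x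
Cylinder-∷ʳ []      p zero    = refl
Cylinder-∷ʳ (b ∷ u) p zero    = p zero
Cylinder-∷ʳ (b ∷ u) {x} p (suc i) = Cylinder-∷ʳ u {x ∘ suc} (p ∘ suc) i

-- The choice of an infinite branch in Kőnig's lemma for the binary tree.
branch : (P : List Bool → Set) → (∀ u → P u → ∃[ b ] P (u ∷ʳ b)) → P [] →
  Σ[ z ∈ Cantor ] (∀ n → P (restrict z n))
branch P step p = path P step p , path-ok P step p
  where
  path : (P : List Bool → Set) → (∀ u → P u → ∃[ b ] P (u ∷ʳ b)) → P [] → Cantor
  path P step p zero    = proj₁ (step [] p)
  -- The first bit is absorbed into the property, so appending at the end still computes.
  path P step p (suc n) =
    path (λ u → P (proj₁ (step [] p) ∷ u)) (λ u → step (_ ∷ u)) (proj₂ (step [] p)) n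

  path-ok : ∀ P step p n → P (restrict (path P step p) n)
  path-ok P step p zero    = p
  path-ok P step p (suc n) =
    path-ok (λ u → P (proj₁ (step [] p) ∷ u)) (λ u → step (_ ∷ u)) (proj₂ (step [] p)) n

-- Finite unions

⋃≤ : (ℕ → Pred Cantor 0ℓ) → ℕ → Pred Cantor 0ℓ
⋃≤ G zero    = G 0
⋃≤ G (suc n) = ⋃≤ G n ∪ G (suc n)

ClosedNull-⋃≤ : ∀ {G} → (∀ n → ClosedNull (G n)) → ∀ n → ClosedNull (⋃≤ G n)
ClosedNull-⋃≤ cn zero    = cn 0
ClosedNull-⋃≤ cn (suc n) = ClosedNull-∪ (ClosedNull-⋃≤ cn n) (cn (suc n))

∈-⋃≤⁺ : ∀ G {i n} → i ≤ℕ n → G i ⊆ ⋃≤ G n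
∈-⋃≤⁺ G {n = zero}  z≤n x∈ = x∈
∈-⋃≤⁺ G {n = suc n} i≤  x∈ with ℕ.m≤n⇒m<n∨m≡n i≤
... | inj₁ (s≤s i≤n) = inj₁ (∈-⋃≤⁺ G i≤n x∈)
... | inj₂ refl      = inj₂ x∈

∈-⋃≤⁻ : ∀ G n {x} → x ∈ ⋃≤ G n → ∃[ i ] (i ≤ℕ n × x ∈ G i)
∈-⋃≤⁻ G zero    x∈        = 0 , z≤n , x∈
∈-⋃≤⁻ G (suc n) (inj₂ x∈) = suc n , ℕ.≤-refl , x∈
∈-⋃≤⁻ G (suc n) (inj₁ x∈) with i , i≤n , p ← ∈-⋃≤⁻ G n x∈ = i , ℕ.m≤n⇒m≤1+n i≤n , p

-- By induction on membership in the ideal. Monotonicity is what later places a point of one `F m`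
-- in all subsequent sets.
exhaustion : ∀ {E} → E ∈ ℰ → Σ[ F ∈ (ℕ → Pred Cantor 0ℓ) ]
  ((∀ n → ClosedNull (F n)) × (∀ {m n} → m ≤ℕ n → F m ⊆ F n) × E ⊆ ⋃ ℕ F)
exhaustion (generator {A} cn) = const A , const cn , (λ _ x∈ → x∈) , λ x∈ → 0 , x∈
exhaustion empty = const ∅ , const ClosedNull-∅ , (λ _ ()) , λ ()
exhaustion (subset A⊆B B∈) with F , cn , mono , B⊆ ← exhaustion B∈ =
  F , cn , mono , λ x∈ → B⊆ (A⊆B x∈)
exhaustion (union A∈) =
  -- A diagonal: stage `N` joins the `N`-th sets of the first `N + 1` sequences; a point of `F n m`
  -- has entered by stage `n ⊔ m`.
  (λ N → ⋃≤ (λ n → F n N) N) ,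
  (λ N → ClosedNull-⋃≤ (λ n → proj₁ (proj₂ (ex n)) N) N) ,
  (λ {m} {n} m≤n x∈ → let i , i≤m , p = ∈-⋃≤⁻ (λ k → F k m) m x∈ in
     ∈-⋃≤⁺ (λ k → F k n) (ℕ.≤-trans i≤m m≤n) (mono i m≤n p)) ,
  λ (n , x∈) → let m , p = proj₂ (proj₂ (proj₂ (ex n))) x∈ in
     n ⊔ m , ∈-⋃≤⁺ (λ k → F k (n ⊔ m)) (ℕ.m≤m⊔n n m) (mono n (ℕ.m≤n⊔m n m) p)
  where
  ex   = λ n → exhaustion (A∈ n)
  F    = λ n → proj₁ (ex n)
  mono = λ n {k l} → proj₁ (proj₂ (proj₂ (ex n))) {k} {l}

-- Blocks of coordinates

Block : ℕ → ℕ → Pred Cantor 0ℓ → Pred Cantor 0ℓ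
Block a b F x = ∃[ y ] (y ∈ F × (∀ i → a ≤ℕ i → i <ℕ b → x i ≡ y i))

Block-resp-Agree : ∀ {a b F x y} → Agree b x y → y ∈ Block a b F → x ∈ Block a b F
Block-resp-Agree agree (z , z∈ , p) = z , z∈ , λ i a≤i i<b → trans (agree i i<b) (p i a≤i i<b)

δ : ℕ → Cantor
δ a i = does (a ≟ℕ i)

-- The closure of `F` under changes of the first `a` coordinates, written as a finite union of
-- translates so that it inherits closedness and nullity.
Saturation : ℕ → Pred Cantor 0ℓ → Pred Cantor 0ℓ
Saturation zero    F = F
Saturation (suc a) F = Saturation a F ∪ (λ x → Saturation a F (x +₂ δ a))

ClosedNull-Saturation : ∀ {F} → ClosedNull F → ∀ a → ClosedNull (Saturation a F)
ClosedNull-Saturation cn zero    = cn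
ClosedNull-Saturation cn (suc a) with c , n ← ClosedNull-Saturation cn a =
  Closed-∪ c (Closed-translate (δ a) c) , Null-∪ n (Null-translate (δ a) n)

-- A countdown from b to 0 for b = 0, 1, 2, …; its current values form a
-- sequence that takes every value infinitely often.
countdown : ℕ → ℕ × ℕ
countdown zero = 0 , 0
countdown (suc n) with countdown n
... | zero  , b = suc b , suc b
... | suc a , b = a , b

task : ℕ → ℕ
task = proj₁ ∘ countdown

countdown-descends : ∀ n a {b t} → countdown n ≡ (a , b) → t ≤ℕ a →
  ∃[ m ] (n ≤ℕ m × countdown m ≡ (t , b))
countdown-descends n a eq t≤a with ℕ.m≤n⇒m<n∨m≡n t≤a
... | inj₂ refl = n , ℕ.≤-refl , eq
countdown-descends n (suc a) {b} eq _ | inj₁ (s≤s t≤a) =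
  let m , n<m , eq′ = countdown-descends (suc n) a (next eq) t≤a in m , ℕ.<⇒≤ n<m , eq′
  where
  next : countdown n ≡ (suc a , b) → countdown (suc n) ≡ (a , b)
  next e rewrite e = refl

-- Every countdown takes at least one stage, so the one from `b` cannot begin before stage `b`.
countdown-start : ∀ b → ∃[ n ] (b ≤ℕ n × countdown n ≡ (b , b))
countdown-start zero = 0 , z≤n , refl
countdown-start (suc b) with n , b≤n , eq ← countdown-start b
  with m , n≤m , eq′ ← countdown-descends n b eq z≤n = suc m , s≤s (ℕ.≤-trans b≤n n≤m) , next eq′
  where
  next : countdown m ≡ (0 , b) → countdown (suc m) ≡ (suc b , suc b)
  next e rewrite e = refl

task-recurs : ∀ t m → ∃[ n ] (m ≤ℕ n × task n ≡ t)
-- The countdown from `t ⊔ m` is high enough to pass `t` and begins late enough to lie beyond `m`.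
task-recurs t m with n , b≤n , eq ← countdown-start (t ⊔ m)
  with k , n≤k , eq′ ← countdown-descends n (t ⊔ m) eq (ℕ.m≤m⊔n t m) =
  k , ℕ.≤-trans (ℕ.m≤n⊔m t m) (ℕ.≤-trans b≤n n≤k) , cong proj₁ eq′

-- Compactness and blocks of small measure

module Classical (em : ExcludedMiddle 0ℓ) where

  dne : {P : Set} → ¬ ¬ P → P
  dne = em⇒dne em

  ¬∀⇒∃¬ : {A : Set} {P : A → Set} → ¬ (∀ x → P x) → ∃[ x ] ¬ P x
  ¬∀⇒∃¬ ¬∀ = dne λ ¬∃ → ¬∀ λ x → dne λ ¬p → ¬∃ (x , ¬p)

  Closed-resp-≗ : ∀ {F x y} → Closed F → x ≗ y → y ∈ F → x ∈ F
  Closed-resp-≗ cF x≗y y∈ = dne λ x∉ → proj₂ (cF _ x∉) _ (λ i _ → x≗y i) y∈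

  -- Compactness: if no `l` is uniform, repeated halving yields a branch `z` none of whose cylinders
  -- is `Good`. But a small cylinder around `z` lies in `V` if `z` is in `F`, and misses `F`
  -- otherwise.
  closed-in-open : ∀ {F V} → Closed F → Open V → F ⊆ V →
    ∃[ l ] (∀ {x} → x ∈ F → ∀ y → Agree l x y → y ∈ V)
  closed-in-open {F} {V} cF oV F⊆V = dne λ ¬l →
    let z , bad = branch (λ u → ¬ Good u) (λ u ¬g → ¬∀⇒∃¬ (¬g ∘ merge u))
                    (λ (l , g) → ¬l (l , λ {x} x∈ → g {x} x∈ λ ()))
    in  case-z z bad em
    where
    Good : List Bool → Set
    Good u = ∃[ l ] (∀ {x} → x ∈ F → Cylinder u x → ∀ y → Agree l x y → y ∈ V)

    merge : ∀ u → (∀ b → Good (u ∷ʳ b)) → Good u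
    merge u g = l false ⊔ l true , λ {x} x∈ c y agree →
        proj₂ (g (x (length u))) x∈ (Cylinder-∷ʳ u {x} c) y
          (λ i i< → agree i (ℕ.<-≤-trans i< (l≤ (x (length u)))))
      where
      l = λ b → proj₁ (g b)
      l≤ : ∀ b → l b ≤ℕ l false ⊔ l true
      l≤ false = ℕ.m≤m⊔n _ _
      l≤ true  = ℕ.m≤n⊔m (l false) _

    case-z : ∀ z → (∀ n → ¬ Good (restrict z n)) → ¬ Dec (z ∈ F)
    case-z z bad (yes z∈) with n , p ← oV z (F⊆V z∈) =
      bad n (n , λ _ c y agree → p y λ i i<n →
        trans (Cylinder-restrict⇒Agree z n c i i<n) (agree i i<n))
    case-z z bad (no z∉) with n , p ← cF z z∉ =
      -- The cylinder contains no point of `F`, so length 0 works vacuously.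
      bad n (0 , λ {x} x∈ c → contradiction x∈ (p x (Cylinder-restrict⇒Agree z n c)))

  -- Differences below `a` are corrected one coordinate at a time, from the top down: a mismatch is
  -- flipped by the translation in `Saturation`.
  ∈-Saturation : ∀ {F} → Closed F → ∀ a {x y} → y ∈ F → (∀ i → a ≤ℕ i → x i ≡ y i) → x ∈ Saturation a F
  ∈-Saturation cF zero    y∈ eq = Closed-resp-≗ cF (λ i → eq i z≤n) y∈
  ∈-Saturation cF (suc a) {x} {y} y∈ eq with x a ≟ y a
  ... | yes e = inj₁ (∈-Saturation cF a y∈ eq′)
    where
    eq′ : ∀ i → a ≤ℕ i → x i ≡ y i
    eq′ i a≤i with ℕ.m≤n⇒m<n∨m≡n a≤i
    ... | inj₁ a<i  = eq i a<i
    ... | inj₂ refl = e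
  ... | no ¬e = inj₂ (∈-Saturation cF a y∈ eq′)
    where
    eq′ : ∀ i → a ≤ℕ i → (x +₂ δ a) i ≡ y i
    eq′ i a≤i with a ≟ℕ i
    ... | no a≢i   = trans (cong (x i xor_) (dec-false (a ≟ℕ i) a≢i))
                       (trans (xor-identityʳ (x i)) (eq i (ℕ.≤∧≢⇒< a≤i a≢i)))
    ... | yes refl = trans (cong (x i xor_) (dec-true (a ≟ℕ a) refl))
                       (trans (xor-comm (x i) true) (sym (¬-not (¬e ∘ sym))))

  -- The saturation of `F` is closed and null, hence has a cover of total at most `ε`. By
  -- compactness the first `l` coordinates decide that points near the saturation are covered, so a
  -- block reaching to `l` suffices.
  thin-block : ∀ {F ε} → ClosedNull F → 0ℚ < ε → ∀ a → ∃[ b ] (a ≤ℕ b × Cover ε (Block a b F))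
  thin-block {F} {ε} cn ε>0 a
    with cS , nS ← ClosedNull-Saturation cn a
    with s , S⊆ , s≤ ← nS ε ε>0
    with l , p ← closed-in-open cS (Open-⋃-Cylinder s) S⊆ =
    a ⊔ l , ℕ.m≤m⊔n a l , s , covered , s≤
    where
    covered : Block a (a ⊔ l) F ⊆ ⋃ ℕ (λ k → Cylinder (s k))
    covered {x} (y , y∈ , eq) =
      p (∈-Saturation (proj₁ cn) a y∈ z≡y) x (λ i i<l → sym (x≡z i (ℕ.m<n⇒m<o⊔n a i<l)))
      where
      -- The hybrid lies in the saturation because of its tail `y`, and agrees with `x` below
      -- `a ⊔ l`.
      z : Cantor
      z i with a ≤ℕ? i
      ... | yes _ = y i
      ... | no  _ = x i
      z≡y : ∀ i → a ≤ℕ i → z i ≡ y i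
      z≡y i a≤i with a ≤ℕ? i
      ... | yes _   = refl
      ... | no  a≰i = contradiction a≤i a≰i
      x≡z : ∀ i → i <ℕ a ⊔ l → x i ≡ z i
      x≡z i i< with a ≤ℕ? i
      ... | yes a≤i = eq i a≤i i<
      ... | no  _   = refl

  glue : (a : ℕ → ℕ) → (∀ n → a n ≤ℕ a (suc n)) → (d : ℕ → Cantor) →
    Σ[ c ∈ Cantor ] (∀ n i → a n ≤ℕ i → i <ℕ a (suc n) → c i ≡ d n i)
  glue a step d = (λ i → pick i em) , λ n i lo hi → pick-ok n i lo hi em
    where
    In : ℕ → ℕ → Set
    In i n = a n ≤ℕ i × i <ℕ a (suc n)

    -- The decision is an argument so that `pick-ok` can split on it. The value `false` fills
    -- coordinates outside all blocks, as the blocks may be empty or fail to exhaust ω.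
    pick : ∀ i → Dec (∃[ n ] In i n) → Bool
    pick i (yes (n , _)) = d n i
    pick i (no _)        = false

    mono : ∀ {m n} → m ≤ℕ n → a m ≤ℕ a n
    mono {n = zero}  z≤n = ℕ.≤-refl
    mono {n = suc n} m≤  with ℕ.m≤n⇒m<n∨m≡n m≤
    ... | inj₁ (s≤s m≤n) = ℕ.≤-trans (mono m≤n) (step n)
    ... | inj₂ refl      = ℕ.≤-refl

    disjoint : ∀ {i m n} → In i m → In i n → m ≤ℕ n
    disjoint (lo , _) (_ , hi) = ℕ.≮⇒≥ λ n<m → ℕ.<⇒≱ hi (ℕ.≤-trans (mono n<m) lo)

    pick-ok : ∀ n i → a n ≤ℕ i → i <ℕ a (suc n) → ∀ dec → pick i dec ≡ d n i
    pick-ok n i lo hi (no ¬p) = contradiction (n , lo , hi) ¬p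
    pick-ok n i lo hi (yes (m , p)) =
      cong (λ k → d k i) (ℕ.≤-antisym (disjoint p (lo , hi)) (disjoint (lo , hi) p))

  -- Otherwise the whole space would be a closed null set, and its intersection with `X`, which is
  -- `X`, would be countable.
  not-null-U : ∀ {X} → X ∈ ℰ-Luzin → ¬ Null U
  not-null-U (¬ctbl , luzin) nU
    with f , p ← luzin U (generator ((λ _ x∉ → contradiction _ x∉) , nU)) =
    ¬ctbl (f , λ x x∈ → p x (x∈ , _))

  -- This threshold stands in for the computation of the measure of the whole space.
  uncoverable : ∀ {X} → X ∈ ℰ-Luzin → ∃[ N ] ¬ Cover (1/suc N) U
  uncoverable X-luzin = dne λ ¬N → not-null-U X-luzin λ ε ε>0 →
    let N , le = archimedean ε ε>0
        s , U⊆ , s≤ = dne {Cover (1/suc N) U} λ ¬c → ¬N (N , ¬c)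
    in  s , (λ {x} → U⊆ {x}) , λ n → ℚ.≤-trans (s≤ n) le

  thin-blocks : ∀ {F : ℕ → Pred Cantor 0ℓ} → (∀ n → ClosedNull (F n)) → (ε : ℕ → ℚ) → (∀ n → 0ℚ < ε n) →
    Σ[ a ∈ (ℕ → ℕ) ]
      (∀ n → a n ≤ℕ a (suc n) × Cover (ε n) (Block (a n) (a (suc n)) (F n)))
  thin-blocks {F} cn ε ε>0 = a , λ n → proj₂ (next n (a n))
    where
    next : ∀ n a → ∃[ b ] (a ≤ℕ b × Cover (ε n) (Block a b (F n)))
    next n = thin-block (cn n) (ε>0 n)
    a : ℕ → ℕ
    a zero    = 0
    a (suc n) = proj₁ (next n (a n))

  -- The point outside the sumset

  module Construction {X} (X-luzin : X ∈ ℰ-Luzin)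
    (F : ℕ → Pred Cantor 0ℓ) (F-mono : ∀ {m n} → m ≤ℕ n → F m ⊆ F n)
    (N : ℕ) (¬cover : ¬ Cover (1/suc N) U)
    (a : ℕ → ℕ) (a-step : ∀ n → a n ≤ℕ a (suc n))
    (G-cover : ∀ n → Cover (1/suc (N +ℕ n)) (Block (a n) (a (suc n)) (F n))) where

    G : ℕ → Pred Cantor 0ℓ
    G n = Block (a n) (a (suc n)) (F n)

    -- Otherwise the cover of `G n`, of total at most 1/(N+n+1) ≤ 1/(N+1), would cover the whole
    -- space.
    G-proper : ∀ n → ∃[ w ] w ∉ G n
    G-proper n = ¬∀⇒∃¬ {P = G n} λ all → let s , G⊆ , s≤ = G-cover n in
      ¬cover (s , (λ {x} _ → G⊆ (all x)) , λ k → ℚ.≤-trans (s≤ k) (1/suc-antitone N (N +ℕ n) (ℕ.m≤m+n N n)))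

    -- Task 0 marks the reserved blocks; task `suc k` is devoted to `f k`.
    Reserved : ℕ → Pred Cantor 0ℓ
    Reserved m x = ∀ n → m ≤ℕ n → task n ≡ 0 → x ∈ G n

    -- Failure occurs at a single block `n` and is visible in the first `a (suc n)` coordinates.
    Reserved-closed : ∀ m → Closed (Reserved m)
    Reserved-closed m x x∉
      with n , ¬p ← ¬∀⇒∃¬ x∉
      with m≤n , ¬q ← ¬∀⇒∃¬ ¬p
      with t≡0 , x∉G ← ¬∀⇒∃¬ ¬q =
      a (suc n) , λ y agree y∈ → x∉G (Block-resp-Agree agree (y∈ n m≤n t≡0))

    Reserved-null : ∀ m → Null (Reserved m)
    Reserved-null m η η>0
      with M , le ← archimedean η η>0
      -- One late reserved block suffices: `n` beyond `m` makes it binding, `n` beyond `M` makes its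
      -- cover small.
      with n , m⊔M≤n , t≡0 ← task-recurs 0 (m ⊔ M)
      with s , G⊆ , s≤ ← G-cover n =
      s , (λ x∈ → G⊆ (x∈ n (ℕ.≤-trans (ℕ.m≤m⊔n m M) m⊔M≤n) t≡0)) ,
      λ k → ℚ.≤-trans (s≤ k) (ℚ.≤-trans (1/suc-antitone M (N +ℕ n) M≤N+n) le)
      where
      M≤N+n = ℕ.≤-trans (ℕ.≤-trans (ℕ.m≤n⊔m m M) m⊔M≤n) (ℕ.m≤n+m n N)

    E′ : Pred Cantor 0ℓ
    E′ = ⋃ ℕ Reserved

    X∩E′-countable : Countable (X ∩ E′)
    X∩E′-countable = proj₂ X-luzin E′
      (union λ m → generator (Reserved-closed m , Reserved-null m))

    f = proj₁ X∩E′-countable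

    prescribed : ℕ → ℕ → Cantor
    prescribed n zero    = const false
    prescribed n (suc k) = proj₁ (G-proper n) +₂ f k

    c-glued = glue a a-step (λ n → prescribed n (task n))
    c = proj₁ c-glued

    c-on-block : ∀ {n t} → task n ≡ t → ∀ i → a n ≤ℕ i → i <ℕ a (suc n) → c i ≡ prescribed n t i
    c-on-block refl = proj₂ c-glued _

    c-avoids : ∀ x e → x ∈ X → e ∈ ⋃ ℕ F → ¬ (c ≗ x +₂ e)
    c-avoids x e x∈X (m , e∈F) c≗x+e =
      -- Cancelling `f k` shows that the chosen point outside `G n` agrees with `e` on the block.
      proj₂ (G-proper n) (e , F-mono m≤n e∈F , λ i lo hi → xor-cancelʳ (f k i) (begin
        proj₁ (G-proper n) i xor f k i  ≡⟨ c-on-block t≡k i lo hi ⟨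
        c i                             ≡⟨ c≗x+e i ⟩
        x i xor e i                     ≡⟨ cong (_xor e i) (x≗fk i) ⟩
        f k i xor e i                   ≡⟨ xor-comm (f k i) (e i) ⟩
        e i xor f k i                   ∎))
      where
      open ≡-Reasoning
      x∈E′ : x ∈ E′
      -- Here `c` vanishes, so `x` and `e` agree on the block.
      x∈E′ = m , λ n m≤n t≡0 → e , F-mono m≤n e∈F , λ i lo hi →
        xor-shift (x i) (trans (sym (c≗x+e i)) (c-on-block t≡0 i lo hi))
      enumerated = proj₂ X∩E′-countable x (x∈X , x∈E′)
      k = proj₁ enumerated
      x≗fk = proj₂ enumerated
      -- A block devoted to `f k` is sought beyond `m`, where `e` lies in `F n`.
      recurs = task-recurs (suc k) m
      n = proj₁ recurs
      m≤n = proj₁ (proj₂ recurs)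
      t≡k = proj₂ (proj₂ recurs)

theorem5p6 : (∀ {ℓ} → ExcludedMiddle ℓ) →
    ∀ (X : Pred Cantor 0ℓ) → X ∈ ℰ-Luzin → X ∈ ℰ*
theorem5p6 em X X-luzin E E∈ℰ (_ , U⊆) =
  let F , F-cn , F-mono , E⊆ = exhaustion E∈ℰ
      N , ¬cover = uncoverable X-luzin
      a , blocks = thin-blocks {F} F-cn (λ n → 1/suc (N +ℕ n)) (λ n → 1/suc-pos (N +ℕ n))
      open Construction X-luzin F F-mono N ¬cover a (λ n → proj₁ (blocks n)) (λ n → proj₂ (blocks n))
      x , e , x∈X , e∈E , c≗x+e = U⊆ {c} _
  in  c-avoids x e x∈X (E⊆ e∈E) c≗x+e
  where open Classical em
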